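{- Let $\|\cdot\|$ be an arbitrary norm on $\mathbb{R}^2$. Then the set of Dirichlet converging vectors (with respect to $\|\cdot\|$) is uncountable.
   Context: For $\vec v\in\mathbb{R}^2\setminus\mathbb{Q}^2$ and a norm $\|\cdot\|$ on $\mathbb{R}^2$, put $\langle \vec v\rangle=\min\{\|\vec v-\vec p\|:\vec p\in\mathbb{Z}^2\}$. A best approximations sequence of $\vec v$ with respect to $\|\cdot\|$ is a sequence $(q_n,\vec p_n)_{n=0}^\infty\subset\mathbb{N}\times\mathbb{Z}^2$ such that $1=q_0<q_1<\dots$; $q_n=\min\{q\in\mathbb{N}:\langle q\vec v\rangle<\langle q_{n-1}\vec v\rangle\}$ for $n\ge1$; and $\|q_n\vec v-\vec p_n\|=\langle q_n\vec v\rangle$ for all $n$. (It is unique up to finitely many of the $\vec p_n$.) Put $\vec\beta_n(\vec v)=\sqrt{q_{n+1}}\,(q_n\vec v-\vec p_n)$. The vector $\vec v\in\mathbb{R}^2\setminus\mathbb{Q}^2$ is Dirichlet converging with respect to $\|\cdot\|$ if $\lim_{n\to\infty}\|\vec\beta_n(\vec v)\|$ exists. -}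

module Defs where

open import Algebra.Bundles using (CommutativeRing)
open import Algebra.Module.Bundles using (Module)
open import Data.Integer.Base as ℤ using (ℤ; +_; -[1+_])
open import Data.Nat.Base as ℕ using (ℕ; zero; suc)
open import Data.Product.Base using (∃₂; ∃-syntax; _×_; _,_; proj₁; proj₂)
open import Data.Sum.Base using (inj₁; inj₂)
open import Function.Bundles using (Injection)
open import Level using (Level; 0ℓ; _⊔_)
open import Relation.Binary.Bundles using (Setoid; TotalOrder)
open import Relation.Binary.Core using (Rel)
open import Relation.Binary.PropositionalEquality.Core using (_≡_)
open import Relation.Binary.Structures using (IsTotalOrder)
open import Relation.Nullary using (¬_)
open import Relation.Unary using (Pred; Satisfiable; _∈_)
import Algebra.Construct.NaturalChoice.Max as Max
import Algebra.Properties.Semiring.Mult as Multiples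
import Algebra.Module.Construct.DirectProduct as DirectProduct
import Algebra.Module.Construct.TensorUnit as TensorUnit
import Algebra.Properties.Ring as RingProperties
import Relation.Binary.Construct.NonStrictToStrict as ToStrict
import Relation.Binary.Construct.On as On
import Relation.Binary.PropositionalEquality.Properties as ≡

private variable
  a ℓ p : Level

IsMinimum : {A : Set a} → Rel A ℓ → Pred A p → Pred A (a ⊔ ℓ ⊔ p)
IsMinimum _≤_ P m = m ∈ P × (∀ {x} → x ∈ P → m ≤ x)

IsUpperBound : {A : Set a} → Rel A ℓ → Pred A p → Pred A (a ⊔ ℓ ⊔ p)
IsUpperBound _≤_ P b = ∀ {x} → x ∈ P → x ≤ b

IsSupremum : {A : Set a} → Rel A ℓ → Pred A p → Pred A (a ⊔ ℓ ⊔ p)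
IsSupremum _≤_ P = IsMinimum _≤_ (IsUpperBound _≤_ P)

-- A subset is countable (finite subsets included) if it injects into ℕ;
-- elements of the subset are compared by the equality of the ambient setoid.
Countable : (S : Setoid a ℓ) → Pred (Setoid.Carrier S) p → Set (a ⊔ ℓ ⊔ p)
Countable S P = Injection (On.setoid S (proj₁ {B = P})) (≡.setoid ℕ)

-- The axioms of the real numbers, which determine them up to isomorphism.
record CompleteOrderedField : Set₁ where
  infix 4 _≤_
  field
    commutativeRing : CommutativeRing 0ℓ 0ℓ

  open CommutativeRing commutativeRing public

  field
    _≤_             : Rel Carrier 0ℓ
    isTotalOrder    : IsTotalOrder _≈_ _≤_
    0≉1             : ¬ 0# ≈ 1#
    inverse         : ∀ x → ¬ x ≈ 0# → ∃[ y ] x * y ≈ 1#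
    +-monoˡ-≤       : ∀ z {x y} → x ≤ y → x + z ≤ y + z
    *-nonNegative   : ∀ {x y} → 0# ≤ x → 0# ≤ y → 0# ≤ x * y
    supremum        : (P : Pred Carrier 0ℓ) → Satisfiable P →
                      Satisfiable (IsUpperBound _≤_ P) →
                      Satisfiable (IsSupremum _≤_ P)

  open IsTotalOrder isTotalOrder public
    using (total; antisym; ≤-respˡ-≈; ≤-respʳ-≈)
    renaming (refl to ≤-refl; reflexive to ≤-reflexive; trans to ≤-trans)

  totalOrder : TotalOrder 0ℓ 0ℓ 0ℓ
  totalOrder = record { isTotalOrder = isTotalOrder }

  open ToStrict _≈_ _≤_ public using (_<_)

  ∣_∣ : Carrier → Carrier
  ∣ x ∣ = Max._⊔_ totalOrder x (- x)

  fromℕ : ℕ → Carrier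
  fromℕ n = n · 1#
    where open Multiples semiring using () renaming (_×_ to _·_)

  fromℤ : ℤ → Carrier
  fromℤ (+ n)    = fromℕ n
  fromℤ -[1+ n ] = - fromℕ (suc n)

  IsRational : Pred Carrier 0ℓ
  IsRational x = ∃₂ λ (m : ℤ) (n : ℕ) → fromℕ (suc n) * x ≈ fromℤ m

  Convergent : Pred (ℕ → Carrier) 0ℓ
  Convergent x = ∃[ l ] ∀ {ε} → 0# < ε →
    ∃[ N ] ∀ n → N ℕ.≤ n → ∣ x n - l ∣ < ε

module SquareRoot (ℝ : CompleteOrderedField) where
  open CompleteOrderedField ℝ
  open RingProperties ring
    using (-1*x≈-x; -‿involutive; [y-z]x≈yx-zx)

  private
    ≤⇒0≤- : ∀ {x y} → x ≤ y → 0# ≤ y - x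
    ≤⇒0≤- {x} x≤y = ≤-respˡ-≈ (-‿inverseʳ x) (+-monoˡ-≤ (- x) x≤y)

    0≤-⇒≤ : ∀ {x y} → 0# ≤ y - x → x ≤ y
    0≤-⇒≤ {x} {y} 0≤y-x = ≤-respˡ-≈ (+-identityˡ x) (≤-respʳ-≈
      (trans (+-assoc y (- x) x) (trans (+-congˡ (-‿inverseˡ x)) (+-identityʳ y)))
      (+-monoˡ-≤ x 0≤y-x))

    0≤1 : 0# ≤ 1#
    0≤1 with total 0# 1#
    ... | inj₁ 0≤1 = 0≤1
    ... | inj₂ 1≤0 = ≤-respʳ-≈ (trans (-1*x≈-x (- 1#)) (-‿involutive 1#))
                       (*-nonNegative 0≤-1 0≤-1)
      where
      0≤-1 : 0# ≤ - 1#
      0≤-1 = ≤-respʳ-≈ (+-identityˡ (- 1#)) (≤⇒0≤- 1≤0)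

    x≤1+x : ∀ x → x ≤ 1# + x
    x≤1+x x = ≤-respˡ-≈ (+-identityˡ x) (+-monoˡ-≤ x 0≤1)

    1≤x⇒x≤x² : ∀ {x} → 1# ≤ x → x ≤ x * x
    1≤x⇒x≤x² {x} 1≤x = 0≤-⇒≤ (≤-respʳ-≈
      (trans ([y-z]x≈yx-zx x x 1#) (+-congˡ (-‿cong (*-identityˡ x))))
      (*-nonNegative (≤⇒0≤- 1≤x) (≤-trans 0≤1 1≤x)))

    square-bound : ∀ {x y} → 0# ≤ x → y * y ≤ x → y ≤ 1# + x
    square-bound {x} {y} 0≤x y²≤x with total y 1#
    ... | inj₁ y≤1 = ≤-trans y≤1 (≤-respʳ-≈ (+-comm x 1#)
                       (≤-respˡ-≈ (+-identityˡ 1#) (+-monoˡ-≤ 1# 0≤x)))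
    ... | inj₂ 1≤y = ≤-trans (1≤x⇒x≤x² 1≤y) (≤-trans y²≤x (x≤1+x x))

  -- √x = sup {y : y² ≤ x}
  √ : ∀ x → 0# ≤ x → Carrier
  √ x 0≤x = proj₁ (supremum (λ y → y * y ≤ x)
    (0# , ≤-respˡ-≈ (sym (zeroˡ 0#)) 0≤x)
    (1# + x , square-bound 0≤x))

  0≤fromℕ : ∀ n → 0# ≤ fromℕ n
  0≤fromℕ zero    = ≤-refl
  0≤fromℕ (suc n) = ≤-trans (0≤fromℕ n) (x≤1+x (fromℕ n))

module Plane (ℝ : CompleteOrderedField) where
  open CompleteOrderedField ℝ

  ℝ² : Module commutativeRing 0ℓ 0ℓ
  ℝ² = DirectProduct.⟨module⟩ TensorUnit.⟨module⟩ TensorUnit.⟨module⟩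

  open Module ℝ² public
    using (_≈ᴹ_; _+ᴹ_; -ᴹ_; 0ᴹ; _*ₗ_; ≈ᴹ-setoid)
    renaming (Carrierᴹ to Vector)

  infixl 6 _-ᴹ_
  _-ᴹ_ : Vector → Vector → Vector
  v -ᴹ w = v +ᴹ (-ᴹ w)

  fromℤ² : ℤ × ℤ → Vector
  fromℤ² (m , n) = fromℤ m , fromℤ n

  ℚ² : Pred Vector 0ℓ
  ℚ² (x , y) = IsRational x × IsRational y

  record Norm : Set where
    field
      ‖_‖         : Vector → Carrier
      cong        : ∀ {v w} → v ≈ᴹ w → ‖ v ‖ ≈ ‖ w ‖
      nonNegative : ∀ v → 0# ≤ ‖ v ‖
      definite    : ∀ {v} → ‖ v ‖ ≈ 0# → v ≈ᴹ 0ᴹ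
      homogeneous : ∀ c v → ‖ c *ₗ v ‖ ≈ ∣ c ∣ * ‖ v ‖
      triangle    : ∀ v w → ‖ v +ᴹ w ‖ ≤ ‖ v ‖ + ‖ w ‖

module BestApproximations
  (ℝ : CompleteOrderedField) (norm : Plane.Norm ℝ) where
  open CompleteOrderedField ℝ
  open SquareRoot ℝ using (√; 0≤fromℕ)
  open Plane ℝ
  open Norm norm using (‖_‖)

  -- ⟨ v ⟩≐ d reads: the minimum ⟨v⟩ exists and is equal to d.
  ⟨_⟩≐_ : Vector → Pred Carrier 0ℓ
  ⟨ v ⟩≐ d = IsMinimum _≤_ (λ e → ∃[ p ] ‖ v -ᴹ fromℤ² p ‖ ≈ e) d

  -- v ⟨ k ⟩<⟨ l ⟩ reads: ⟨kv⟩ < ⟨lv⟩.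
  _⟨_⟩<⟨_⟩ : Vector → Rel ℕ 0ℓ
  v ⟨ k ⟩<⟨ l ⟩ = ∃₂ λ d e →
    ⟨ fromℕ k *ₗ v ⟩≐ d × ⟨ fromℕ l *ₗ v ⟩≐ e × d < e

  record IsBestApproximationsSequence
    (v : Vector) (q : ℕ → ℕ) (p : ℕ → ℤ × ℤ) : Set where
    field
      initial    : q 0 ≡ 1
      increasing : ∀ n → q n ℕ.< q (suc n)
      -- 1 ≤ k: the denominators range over positive integers.
      minimal    : ∀ n → IsMinimum ℕ._≤_
                     (λ k → 1 ℕ.≤ k × v ⟨ k ⟩<⟨ q n ⟩) (q (suc n))
      nearest    : ∀ n → ⟨ fromℕ (q n) *ₗ v ⟩≐ ‖ fromℕ (q n) *ₗ v -ᴹ fromℤ² (p n) ‖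

  β : Vector → (ℕ → ℕ) → (ℕ → ℤ × ℤ) → ℕ → Vector
  β v q p n = √ (fromℕ (q (suc n))) (0≤fromℕ (q (suc n)))
    *ₗ (fromℕ (q n) *ₗ v -ᴹ fromℤ² (p n))

  DirichletConverging : Pred Vector 0ℓ
  DirichletConverging v = ¬ v ∈ ℚ² × ∃₂ λ q p →
    IsBestApproximationsSequence v q p × Convergent (λ n → ‖ β v q p n ‖)

{-# OPTIONS --safe #-}

-- Every v = (α , 0) with α ≥ 0 irrational and small is Dirichlet converging, with
-- limit 0. Points with a nonzero integral second coordinate have norm at least some
-- c > 0, so once α‖(1,0)‖ ≤ c the best approximations of v are those of α on the line.
-- With D k the distance from kα to ℤ, Dirichlet's pigeonhole argument yields
-- q_{n+1} D(q_n) ≤ 2, hence √q_{n+1} D(q_n) → 0. Cantor's nested intervals give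
-- uncountably many such α.

module Submission where

open import Defs
open import Axiom.ExcludedMiddle using (ExcludedMiddle)
open import Level using (0ℓ)
open import Relation.Nullary using (¬_)

open import Algebra.Solver.Ring.AlmostCommutativeRing
  using (fromCommutativeRing; _-Raw-AlmostCommutative⟶_)
open import Data.Fin.Base as Fin using (Fin)
open import Data.Integer.Base as ℤ using (ℤ; +_; -[1+_]; _⊖_)
open import Data.Maybe.Base using (Maybe; just; nothing)
open import Data.Nat.Base as ℕ using (ℕ; zero; suc)
open import Data.Product.Base using (∃; ∃₂; ∃-syntax; _×_; _,_; proj₁; proj₂; uncurry)
open import Data.Sum.Base using (_⊎_; inj₁; inj₂; [_,_]′)
open import Function.Base using (id)
open import Function.Bundles using (Injection)
open import Relation.Binary.Bundles using (TotalOrder)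
open import Relation.Binary.PropositionalEquality.Core as ≡ using (_≡_)
open import Relation.Nullary using (Dec; yes; no; contradiction)
open import Relation.Nullary.Decidable using (decidable-stable)
import Algebra.Construct.NaturalChoice.Max as Max
import Algebra.Properties.Group as GroupProperties
import Algebra.Properties.Ring as RingProperties
import Algebra.Properties.Semiring.Mult as Multiples
import Algebra.Solver.Ring as RingSolver
import Data.Fin.Properties as Fin
import Data.Integer.Properties as ℤ
import Data.Nat.Properties as ℕ
import Relation.Binary.Properties.TotalOrder as TotalOrderProperties
import Relation.Binary.Reasoning.PartialOrder as PartialOrderReasoning
import Relation.Binary.Reasoning.Setoid as SetoidReasoning

-- On such a line approximation is one-dimensional: D(q_n) is at most of order 1/q_{n+1}, whereas
-- the factor √q_{n+1} is scaled for the plane, and the product decays at least like 1/√q_{n+1}. The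
-- obstacle is the arbitrary norm: for some k a lattice point off the axis may be closer to kv than
-- every lattice point on it. It does no harm, because D(q_n) ≤ D(1) ≤ α: one bound on α keeps all
-- the q_n v close to the axis lattice, and any other k only has to be compared with some q_n.
-- Excluded middle supplies least denominators, since comparison of reals is not decidable, and
-- inverts a supposed injection into ℕ.

-- Integers in the field and the ring solver.

module IntegerEmbedding (ℝ : CompleteOrderedField) where
  open CompleteOrderedField ℝ hiding (zero)
  open RingProperties ring
  open SetoidReasoning setoid

  fromℕ-+ : ∀ m n → fromℕ (m ℕ.+ n) ≈ fromℕ m + fromℕ n
  fromℕ-+ = Multiples.×-homo-+ semiring 1#

  fromℤ-⊖ : ∀ m n → fromℤ (m ⊖ n) ≈ fromℕ m - fromℕ n
  fromℤ-⊖ zero    zero    = sym (-‿inverseʳ 0#)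
  fromℤ-⊖ zero    (suc n) = sym (+-identityˡ _)
  fromℤ-⊖ (suc m) zero    = sym (trans (+-congˡ -0#≈0#) (+-identityʳ _))
  fromℤ-⊖ (suc m) (suc n) = begin
    fromℤ (suc m ⊖ suc n)                 ≡⟨ ≡.cong fromℤ (ℤ.[1+m]⊖[1+n]≡m⊖n m n) ⟩
    fromℤ (m ⊖ n)                         ≈⟨ fromℤ-⊖ m n ⟩
    fromℕ m - fromℕ n                     ≈⟨ +-congʳ (+-identityˡ _) ⟨
    (0# + fromℕ m) - fromℕ n              ≈⟨ +-congʳ (+-congʳ (-‿inverseˡ 1#)) ⟨
    ((- 1# + 1#) + fromℕ m) - fromℕ n     ≈⟨ +-congʳ (+-assoc _ _ _) ⟩
    (- 1# + fromℕ (suc m)) - fromℕ n      ≈⟨ +-congʳ (+-comm _ _) ⟩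
    (fromℕ (suc m) - 1#) - fromℕ n        ≈⟨ +-assoc _ _ _ ⟩
    fromℕ (suc m) + (- 1# - fromℕ n)      ≈⟨ +-congˡ (-‿+-comm 1# (fromℕ n)) ⟩
    fromℕ (suc m) - fromℕ (suc n)         ∎

  fromℤ-neg : ∀ i → fromℤ (ℤ.- i) ≈ - fromℤ i
  fromℤ-neg (+ zero)  = sym -0#≈0#
  fromℤ-neg (+ suc n) = refl
  fromℤ-neg -[1+ n ]  = sym (-‿involutive _)

  fromℤ-+ : ∀ i j → fromℤ (i ℤ.+ j) ≈ fromℤ i + fromℤ j
  fromℤ-+ (+ m)    (+ n)    = fromℕ-+ m n
  fromℤ-+ (+ m)    -[1+ n ] = fromℤ-⊖ m (suc n)
  fromℤ-+ -[1+ m ] (+ n)    = trans (fromℤ-⊖ n (suc m)) (+-comm _ _)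
  fromℤ-+ -[1+ m ] -[1+ n ] = begin
    - fromℕ (suc (suc (m ℕ.+ n)))     ≡⟨ ≡.cong (λ k → - fromℕ (suc k)) (ℕ.+-suc m n) ⟨
    - fromℕ (suc m ℕ.+ suc n)         ≈⟨ -‿cong (fromℕ-+ (suc m) (suc n)) ⟩
    - (fromℕ (suc m) + fromℕ (suc n)) ≈⟨ -‿+-comm _ _ ⟨
    - fromℕ (suc m) - fromℕ (suc n)   ∎

  fromℤ-*⁺ : ∀ m j → fromℤ (+ m ℤ.* j) ≈ fromℕ m * fromℤ j
  fromℤ-*⁺ m (+ n) = begin
    fromℤ (+ m ℤ.* + n) ≡⟨ ≡.cong fromℤ (ℤ.pos-* m n) ⟨
    fromℕ (m ℕ.* n)     ≈⟨ Multiples.×1-homo-* semiring m n ⟩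
    fromℕ m * fromℕ n   ∎
  fromℤ-*⁺ m -[1+ n ] = begin
    fromℤ (+ m ℤ.* -[1+ n ])        ≡⟨ ≡.cong fromℤ (ℤ.neg-distribʳ-* (+ m) (+ suc n)) ⟨
    fromℤ (ℤ.- (+ m ℤ.* + suc n))   ≈⟨ fromℤ-neg (+ m ℤ.* + suc n) ⟩
    - fromℤ (+ m ℤ.* + suc n)       ≈⟨ -‿cong (fromℤ-*⁺ m (+ suc n)) ⟩
    - (fromℕ m * fromℕ (suc n))     ≈⟨ -‿distribʳ-* _ _ ⟩
    fromℕ m * - fromℕ (suc n)       ∎

  fromℤ-* : ∀ i j → fromℤ (i ℤ.* j) ≈ fromℤ i * fromℤ j
  fromℤ-* (+ m)    j = fromℤ-*⁺ m j
  fromℤ-* -[1+ m ] j = begin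
    fromℤ (-[1+ m ] ℤ.* j)         ≡⟨ ≡.cong fromℤ (ℤ.neg-distribˡ-* (+ suc m) j) ⟨
    fromℤ (ℤ.- (+ suc m ℤ.* j))    ≈⟨ fromℤ-neg (+ suc m ℤ.* j) ⟩
    - fromℤ (+ suc m ℤ.* j)        ≈⟨ -‿cong (fromℤ-*⁺ (suc m) j) ⟩
    - (fromℕ (suc m) * fromℤ j)    ≈⟨ -‿distribˡ-* _ _ ⟩
    - fromℕ (suc m) * fromℤ j      ∎

  fromℕ-1 : fromℕ 1 ≈ 1#
  fromℕ-1 = +-identityʳ 1#

  morphism : ℤ.+-*-rawRing -Raw-AlmostCommutative⟶ fromCommutativeRing commutativeRing
  morphism = record
    { ⟦_⟧    = fromℤ
    ; +-homo = fromℤ-+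
    ; *-homo = fromℤ-*
    ; -‿homo = fromℤ-neg
    ; 0-homo = refl
    ; 1-homo = fromℕ-1
    }

  fromℤ-≟ : ∀ i j → Maybe (fromℤ i ≈ fromℤ j)
  fromℤ-≟ i j with i ℤ.≟ j
  ... | yes ≡.refl = just refl
  ... | no  _      = nothing

  -- The coefficient `+ 1` denotes `1# + 0#` rather than `1#`, so `1#` enters the solver calls as a
  -- variable, while `con (+ 0)` is `0#` itself.
  open RingSolver ℤ.+-*-rawRing (fromCommutativeRing commutativeRing) morphism fromℤ-≟ public
    using (solve; _:+_; _:*_; _:-_; :-_; _:=_; con)

-- Ordered field arithmetic and absolute values.

module Order (ℝ : CompleteOrderedField) where
  open CompleteOrderedField ℝ hiding (zero)
  open IntegerEmbedding ℝ
  open SquareRoot ℝ using (0≤fromℕ)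
  open Max totalOrder
  open RingProperties ring using (-‿distribʳ-*)
  open PartialOrderReasoning (TotalOrder.poset totalOrder) public
  open TotalOrderProperties totalOrder public
    using (≰⇒>; ≰⇒≥; <⇒≱; ≤∧≉⇒<)

  ≤⇒0≤- : ∀ {x y} → x ≤ y → 0# ≤ y - x
  ≤⇒0≤- {x} x≤y = ≤-respˡ-≈ (-‿inverseʳ x) (+-monoˡ-≤ (- x) x≤y)

  0≤-⇒≤ : ∀ {x y} → 0# ≤ y - x → x ≤ y
  0≤-⇒≤ {x} {y} 0≤y-x = ≤-respˡ-≈ (+-identityˡ x) (≤-respʳ-≈
    (solve 2 (λ x y → (y :- x) :+ x := y) refl x y) (+-monoˡ-≤ x 0≤y-x))

  -- The solver reduces an inequality to another one with the same difference.
  ≤-by : ∀ {u v x y} → v - u ≈ y - x → u ≤ v → x ≤ y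
  ≤-by eq u≤v = 0≤-⇒≤ (≤-respʳ-≈ eq (≤⇒0≤- u≤v))

  +-mono-≤ : ∀ {x y u v} → x ≤ y → u ≤ v → x + u ≤ y + v
  +-mono-≤ {x} {y} {u} {v} x≤y u≤v = ≤-trans (+-monoˡ-≤ u x≤y)
    (≤-by (solve 3 (λ y u v → v :- u := (y :+ v) :- (y :+ u)) refl y u v) u≤v)

  +-cancelˡ-≤ : ∀ {z x y} → z + x ≤ z + y → x ≤ y
  +-cancelˡ-≤ {z} {x} {y} =
    ≤-by (solve 3 (λ z x y → (z :+ y) :- (z :+ x) := y :- x) refl z x y)

  +-cancelʳ-≤ : ∀ {z x y} → x + z ≤ y + z → x ≤ y
  +-cancelʳ-≤ {z} {x} {y} =
    ≤-by (solve 3 (λ z x y → (y :+ z) :- (x :+ z) := y :- x) refl z x y)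

  *-monoˡ-≤ : ∀ {z x y} → 0# ≤ z → x ≤ y → z * x ≤ z * y
  *-monoˡ-≤ {z} {x} {y} 0≤z x≤y = 0≤-⇒≤ (≤-respʳ-≈
    (solve 3 (λ z x y → z :* (y :- x) := z :* y :- z :* x) refl z x y)
    (*-nonNegative 0≤z (≤⇒0≤- x≤y)))

  *-monoʳ-≤ : ∀ {z x y} → 0# ≤ z → x ≤ y → x * z ≤ y * z
  *-monoʳ-≤ {z} {x} {y} 0≤z x≤y =
    ≤-respˡ-≈ (*-comm z x) (≤-respʳ-≈ (*-comm z y) (*-monoˡ-≤ 0≤z x≤y))

  0≤1 : 0# ≤ 1#
  0≤1 = ≤-respʳ-≈ fromℕ-1 (0≤fromℕ 1)

  1≰0 : ¬ 1# ≤ 0#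
  1≰0 1≤0 = 0≉1 (antisym 0≤1 1≤0)

  fromℕ-mono : ∀ m n → m ℕ.≤ n → fromℕ m ≤ fromℕ n
  fromℕ-mono zero    n       _ = 0≤fromℕ n
  fromℕ-mono (suc m) (suc n) (ℕ.s≤s m≤n) = +-mono-≤ ≤-refl (fromℕ-mono m n m≤n)

  0<fromℕ-suc : ∀ n → 0# < fromℕ (suc n)
  0<fromℕ-suc n = ≰⇒> λ n≤0 → 1≰0 (begin
    1#            ≈⟨ fromℕ-1 ⟨
    fromℕ 1       ≤⟨ fromℕ-mono 1 (suc n) (ℕ.s≤s ℕ.z≤n) ⟩
    fromℕ (suc n) ≤⟨ n≤0 ⟩
    0#            ∎)

  reciprocal : ∀ {x} → 0# < x → ∃[ y ] (0# < y × x * y ≈ 1#)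
  reciprocal {x} 0<x@(0≤x , 0≉x) with y , xy≈1 ← inverse x (λ x≈0 → 0≉x (sym x≈0)) =
    y , ≰⇒> y≰0 , xy≈1
    where
    y≰0 : ¬ y ≤ 0#
    y≰0 y≤0 = 1≰0 (begin
      1#     ≈⟨ xy≈1 ⟨
      x * y  ≤⟨ *-monoˡ-≤ 0≤x y≤0 ⟩
      x * 0# ≈⟨ zeroʳ x ⟩
      0#     ∎)

  *-cancelˡ-≤ : ∀ {z x y} → 0# < z → z * x ≤ z * y → x ≤ y
  *-cancelˡ-≤ {z} {x} {y} 0<z zx≤zy = begin
    x           ≈⟨ cancel x ⟨
    w * (z * x) ≤⟨ *-monoˡ-≤ (proj₁ 0<w) zx≤zy ⟩
    w * (z * y) ≈⟨ cancel y ⟩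
    y           ∎
    where
    w : Carrier
    w = proj₁ (reciprocal 0<z)

    0<w : 0# < w
    0<w = proj₁ (proj₂ (reciprocal 0<z))

    cancel : ∀ x → w * (z * x) ≈ x
    cancel x = trans (solve 3 (λ w z x → w :* (z :* x) := z :* w :* x) refl w z x)
      (trans (*-congʳ (proj₂ (proj₂ (reciprocal 0<z)))) (*-identityˡ x))

  *-positive : ∀ {x y} → 0# < x → 0# < y → 0# < x * y
  *-positive {x} {y} 0<x 0<y = ≰⇒> λ xy≤0 →
    <⇒≱ 0<y (*-cancelˡ-≤ 0<x (≤-respʳ-≈ (sym (zeroʳ x)) xy≤0))

  0<2 : 0# < 1# + 1#
  0<2 = ≰⇒> λ 2≤0 → 1≰0 (≤-trans (≤-respˡ-≈ (+-identityʳ 1#) (+-mono-≤ ≤-refl 0≤1)) 2≤0)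

  half : ∀ x → ∃[ y ] y + y ≈ x
  half x = h * x , trans (sym (distribʳ x h h)) (trans (*-congʳ h+h≈1) (*-identityˡ x))
    where
    h : Carrier
    h = proj₁ (reciprocal 0<2)

    h+h≈1 : h + h ≈ 1#
    h+h≈1 = trans (sym (+-cong (*-identityˡ h) (*-identityˡ h)))
      (trans (sym (distribʳ h 1# 1#)) (proj₂ (proj₂ (reciprocal 0<2))))

  half-positive : ∀ {x y} → y + y ≈ x → 0# < x → 0# < y
  half-positive {x} {y} y+y≈x 0<x = ≰⇒> λ y≤0 → <⇒≱ 0<x (begin
    x       ≈⟨ y+y≈x ⟨
    y + y   ≤⟨ +-mono-≤ y≤0 y≤0 ⟩
    0# + 0# ≈⟨ +-identityˡ 0# ⟩
    0#      ∎)

  between : ∀ {x y} → x < y → ∃[ m ] (x < m × m < y)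
  between {x} {y} x<y = m , ≰⇒> m≰x , ≰⇒> y≰m
    where
    m : Carrier
    m = proj₁ (half (x + y))

    m+m≈x+y : m + m ≈ x + y
    m+m≈x+y = proj₂ (half (x + y))

    m≰x : ¬ m ≤ x
    m≰x m≤x = <⇒≱ x<y (+-cancelˡ-≤ (≤-respˡ-≈ m+m≈x+y (+-mono-≤ m≤x m≤x)))

    y≰m : ¬ y ≤ m
    y≰m y≤m = <⇒≱ x<y (+-cancelʳ-≤ (≤-respʳ-≈ m+m≈x+y (+-mono-≤ y≤m y≤m)))

  x≤∣x∣ : ∀ x → x ≤ ∣ x ∣
  x≤∣x∣ x = x≤x⊔y x (- x)

  -x≤∣x∣ : ∀ x → - x ≤ ∣ x ∣
  -x≤∣x∣ x = x≤y⊔x x (- x)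

  ∣x∣≤ : ∀ {x y} → x ≤ y → - x ≤ y → ∣ x ∣ ≤ y
  ∣x∣≤ = ⊔-lub

  0≤x⇒∣x∣≈x : ∀ {x} → 0# ≤ x → ∣ x ∣ ≈ x
  0≤x⇒∣x∣≈x {x} 0≤x = x≤y⇒y⊔x≈y (≤-trans
    (≤-by (solve 1 (λ x → x :- con (+ 0) := con (+ 0) :- :- x) refl x) 0≤x) 0≤x)

  ∣-∣-cong : ∀ {x y} → x ≈ y → ∣ x ∣ ≈ ∣ y ∣
  ∣-∣-cong x≈y = ⊔-cong x≈y (-‿cong x≈y)

  0≤∣x∣ : ∀ x → 0# ≤ ∣ x ∣
  0≤∣x∣ x with total 0# x
  ... | inj₁ 0≤x = ≤-trans 0≤x (x≤∣x∣ x)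
  ... | inj₂ x≤0 = ≤-trans
    (≤-by (solve 1 (λ x → con (+ 0) :- x := :- x :- con (+ 0)) refl x) x≤0) (-x≤∣x∣ x)

  ∣x∣≤0⇒x≈0 : ∀ {x} → ∣ x ∣ ≤ 0# → x ≈ 0#
  ∣x∣≤0⇒x≈0 {x} ∣x∣≤0 = antisym (≤-trans (x≤∣x∣ x) ∣x∣≤0)
    (≤-by (solve 1 (λ x → con (+ 0) :- :- x := x :- con (+ 0)) refl x) (≤-trans (-x≤∣x∣ x) ∣x∣≤0))

  ∣y-x∣≈y-x : ∀ {x y} → x ≤ y → ∣ y - x ∣ ≈ y - x
  ∣y-x∣≈y-x x≤y = 0≤x⇒∣x∣≈x (≤⇒0≤- x≤y)

  ∣x-y∣≈y-x : ∀ {x y} → x ≤ y → ∣ x - y ∣ ≈ y - x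
  ∣x-y∣≈y-x {x} {y} x≤y = antisym
    (∣x∣≤ (≤-by (solve 2 (λ x y → (y :+ y) :- (x :+ x) := (y :- x) :- (x :- y)) refl x y)
             (+-mono-≤ x≤y x≤y))
           (≤-reflexive (solve 2 (λ x y → :- (x :- y) := y :- x) refl x y)))
    (≤-respˡ-≈ (solve 2 (λ x y → :- (x :- y) := y :- x) refl x y) (-x≤∣x∣ (x - y)))

  *-∣-∣-≤ : ∀ {x y z} → x * y ≤ z → - (x * y) ≤ z → x * ∣ y ∣ ≤ z
  *-∣-∣-≤ {x} {y} xy≤z -xy≤z =
    [ (λ ∣y∣≈y → ≤-respˡ-≈ (sym (*-congˡ ∣y∣≈y)) xy≤z)
    , (λ ∣y∣≈-y → ≤-respˡ-≈ (trans (-‿distribʳ-* x y) (sym (*-congˡ ∣y∣≈-y))) -xy≤z)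
    ]′ (⊔-sel y (- y))

  x+x≤y+y⇒x≤y : ∀ {x y} → x + x ≤ y + y → x ≤ y
  x+x≤y+y⇒x≤y {x} {y} x+x≤y+y =
    [ id , (λ y≤x → +-cancelʳ-≤ (≤-trans x+x≤y+y (+-mono-≤ ≤-refl y≤x))) ]′ (total x y)

-- The Archimedean property and nearest integers.

module Archimedean (em : ExcludedMiddle 0ℓ) (ℝ : CompleteOrderedField) where
  open CompleteOrderedField ℝ hiding (zero)
  open IntegerEmbedding ℝ
  open SquareRoot ℝ using (0≤fromℕ)
  open Order ℝ

  -- Otherwise the reals lying below some natural number have a supremum s. Along with n they
  -- contain n + 1, so s - 1 is already an upper bound.
  archimedean : ∀ x → ∃[ n ] x ≤ fromℕ n
  archimedean x = decidable-stable em unbounded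
    where
    unbounded : ¬ ¬ (∃[ n ] x ≤ fromℕ n)
    unbounded ∄n = 1≰0 (≤-by
      (solve 2 (λ s o → (s :- o) :- s := con (+ 0) :- o) refl s 1#) (least s-1-isUpperBound))
      where
      fromℕ≤x : ∀ n → fromℕ n ≤ x
      fromℕ≤x n = [ (λ x≤n → contradiction (n , x≤n) ∄n) , id ]′ (total x (fromℕ n))

      sup = supremum (λ y → ∃[ n ] y ≤ fromℕ n) (0# , 0 , ≤-refl)
        (x , λ (n , y≤n) → ≤-trans y≤n (fromℕ≤x n))

      s : Carrier
      s = proj₁ sup

      least = proj₂ (proj₂ sup)

      s-1-isUpperBound : IsUpperBound _≤_ (λ y → ∃[ n ] y ≤ fromℕ n) (s - 1#)
      s-1-isUpperBound (n , y≤n) = ≤-trans y≤n (≤-by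
        (solve 3 (λ s o n → s :- (o :+ n) := (s :- o) :- n) refl s 1# (fromℕ n))
        (proj₁ (proj₂ sup) (suc n , ≤-refl)))

  -- The upper inequality is weak, so m need not be the floor of an integer x.
  floor : ∀ {x} n → 0# ≤ x → x ≤ fromℕ (suc n) →
          ∃[ m ] (m ℕ.≤ n × fromℕ m ≤ x × x ≤ fromℕ (suc m))
  floor     zero    0≤x x≤1 = 0 , ℕ.z≤n , 0≤x , x≤1
  floor {x} (suc n) 0≤x x≤2+n with total x (fromℕ (suc n))
  ... | inj₂ 1+n≤x = suc n , ℕ.≤-refl , 1+n≤x , x≤2+n
  ... | inj₁ x≤1+n = let m , m≤n , m≤x , x≤1+m = floor n 0≤x x≤1+n in
    m , ℕ.m≤n⇒m≤1+n m≤n , m≤x , x≤1+m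

  IsNearest : Carrier → ℤ → Set
  IsNearest x p = ∀ r → ∣ x - fromℤ p ∣ ≤ ∣ x - fromℤ r ∣

  module _ {x m} (m≤x : fromℕ m ≤ x) (x≤1+m : x ≤ fromℕ (suc m)) where
    private
      -- No integer lies strictly between m and m + 1, so the two end distances control all the
      -- others. With `e` as a parameter, the same argument serves whichever end is the closer one.
      lower : ∀ e → e ≤ x - fromℕ m → e ≤ fromℕ (suc m) - x → ∀ r → e ≤ ∣ x - fromℤ r ∣
      lower e e≤x-m e≤1+m-x -[1+ k ] = begin
        e                     ≤⟨ e≤x-m ⟩
        x - fromℕ m           ≤⟨ ≤-by
          (solve 3 (λ x m k → (m :+ k) :- con (+ 0) := (x :- :- k) :- (x :- m))
            refl x (fromℕ m) (fromℕ (suc k)))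
          (≤-respˡ-≈ (+-identityˡ 0#) (+-mono-≤ (0≤fromℕ m) (0≤fromℕ (suc k)))) ⟩
        x - - fromℕ (suc k)   ≤⟨ x≤∣x∣ _ ⟩
        ∣ x - - fromℕ (suc k) ∣ ∎
      lower e e≤x-m e≤1+m-x (+ k) with ℕ.≤-<-connex k m
      ... | inj₁ k≤m = begin
        e                     ≤⟨ e≤x-m ⟩
        x - fromℕ m           ≤⟨ ≤-by
          (solve 3 (λ x m k → m :- k := (x :- k) :- (x :- m)) refl x (fromℕ m) (fromℕ k))
          (fromℕ-mono k m k≤m) ⟩
        x - fromℕ k           ≤⟨ x≤∣x∣ _ ⟩
        ∣ x - fromℕ k ∣       ∎
      ... | inj₂ m<k = begin
        e                     ≤⟨ e≤1+m-x ⟩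
        fromℕ (suc m) - x     ≤⟨ ≤-by
          (solve 3 (λ x m k → k :- m := :- (x :- k) :- (m :- x)) refl x (fromℕ (suc m)) (fromℕ k))
          (fromℕ-mono (suc m) k m<k) ⟩
        - (x - fromℕ k)       ≤⟨ -x≤∣x∣ _ ⟩
        ∣ x - fromℕ k ∣       ∎

    nearest-floor : ∃[ p ] IsNearest x p
    nearest-floor = [ below , above ]′ (total (x - fromℕ m) (fromℕ (suc m) - x))
      where
      below : x - fromℕ m ≤ fromℕ (suc m) - x → ∃[ p ] IsNearest x p
      below x-m≤1+m-x = + m , lower _
        (≤-reflexive (∣y-x∣≈y-x m≤x)) (≤-respˡ-≈ (sym (∣y-x∣≈y-x m≤x)) x-m≤1+m-x)

      above : fromℕ (suc m) - x ≤ x - fromℕ m → ∃[ p ] IsNearest x p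
      above 1+m-x≤x-m = + suc m , lower _
        (≤-respˡ-≈ (sym (∣x-y∣≈y-x x≤1+m)) 1+m-x≤x-m) (≤-reflexive (∣x-y∣≈y-x x≤1+m))

  integerPart : ∀ {x} → 0# ≤ x → ∃[ m ] (fromℕ m ≤ x × x ≤ fromℕ (suc m))
  integerPart {x} 0≤x =
    let n , x≤n = archimedean x
        m , _ , m≤x , x≤1+m = floor n 0≤x (≤-trans x≤n (fromℕ-mono n (suc n) (ℕ.n≤1+n n)))
    in m , m≤x , x≤1+m

  nearest : ∀ {x} → 0# ≤ x → ∃[ p ] IsNearest x p
  nearest {x} 0≤x = let m , m≤x , x≤1+m = integerPart 0≤x in nearest-floor {x} {m} m≤x x≤1+m

-- Cantor's nested intervals.

module Uncountability (ℝ : CompleteOrderedField) where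
  open CompleteOrderedField ℝ hiding (zero)
  open Order ℝ

  private
    successor : ℕ × ℕ → ℕ × ℕ
    successor (zero  , j) = suc j , 0
    successor (suc i , j) = i , suc j

  -- Cantor's enumeration of ℕ × ℕ along the antidiagonals.
  unpair : ℕ → ℕ × ℕ
  unpair zero    = 0 , 0
  unpair (suc n) = successor (unpair n)

  unpair-surjective : ∀ i j → ∃[ n ] unpair n ≡ (i , j)
  unpair-surjective i j = go (i ℕ.+ j) i j ≡.refl
    where
    -- Steps backwards along `successor`: up the antidiagonal while `j` is positive, then to the end
    -- of the previous one. The pair (s, j) decreases lexicographically.
    go : ∀ s i j → i ℕ.+ j ≡ s → ∃[ n ] unpair n ≡ (i , j)
    go s       zero    zero    _    = 0 , ≡.refl
    go (suc s) (suc i) zero    i+0≡s =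
      let n , eq = go s zero i (≡.trans (≡.sym (ℕ.+-identityʳ i)) (ℕ.suc-injective i+0≡s))
      in suc n , ≡.cong successor eq
    go s       i       (suc j) i+j≡s =
      let n , eq = go s (suc i) j (≡.trans (≡.sym (ℕ.+-suc i j)) i+j≡s)
      in suc n , ≡.cong successor eq

  record Interval : Set where
    constructor interval
    field
      {lo hi} : Carrier
      lo<hi   : lo < hi

  open Interval

  _∈_ : Carrier → Interval → Set
  x ∈ I = lo I ≤ x × x ≤ hi I

  Avoids : Carrier → Interval → Set
  Avoids z I = ∀ {x} → x ∈ I → ¬ x ≈ z

  -- `z` lies on one side of the midpoint `m`. The other half is cut a second time because `z` may
  -- equal `m`.
  avoid : ∀ z I → ∃[ J ] (lo I ≤ lo J × hi J ≤ hi I × Avoids z J)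
  avoid z I = [ right , left ]′ (total z m)
    where
    m   = proj₁ (between (lo<hi I))
    l<m = proj₁ (proj₂ (between (lo<hi I)))
    m<h = proj₂ (proj₂ (between (lo<hi I)))

    right : z ≤ m → ∃[ J ] (lo I ≤ lo J × hi J ≤ hi I × Avoids z J)
    right z≤m = let _ , m<m′ , m′<h = between m<h in
      interval m′<h , ≤-trans (proj₁ l<m) (proj₁ m<m′) , ≤-refl ,
      λ (m′≤x , _) x≈z → <⇒≱ m<m′ (≤-trans m′≤x (≤-trans (≤-reflexive x≈z) z≤m))

    left : m ≤ z → ∃[ J ] (lo I ≤ lo J × hi J ≤ hi I × Avoids z J)
    left m≤z = let _ , l<m′ , m′<m = between l<m in
      interval l<m′ , ≤-refl , ≤-trans (proj₁ m′<m) (proj₁ m<h) ,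
      λ (_ , x≤m′) x≈z → <⇒≱ m′<m (≤-trans m≤z (≤-trans (≤-reflexive (sym x≈z)) x≤m′))

  module _ (z : ℕ → Carrier) (I₀ : Interval) where
    private
      I : ℕ → Interval
      I zero    = I₀
      I (suc n) = proj₁ (avoid (z n) (I n))

      lo-mono : ∀ {m n} → m ℕ.≤′ n → lo (I m) ≤ lo (I n)
      lo-mono (ℕ.≤′-reflexive ≡.refl) = ≤-refl
      lo-mono (ℕ.≤′-step {n} m≤n)     = ≤-trans (lo-mono m≤n) (proj₁ (proj₂ (avoid (z n) (I n))))

      hi-anti : ∀ {m n} → m ℕ.≤′ n → hi (I n) ≤ hi (I m)
      hi-anti (ℕ.≤′-reflexive ≡.refl) = ≤-refl
      hi-anti (ℕ.≤′-step {n} m≤n)     = ≤-trans (proj₁ (proj₂ (proj₂ (avoid (z n) (I n))))) (hi-anti m≤n)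

      lo≤hi : ∀ m n → lo (I m) ≤ hi (I n)
      lo≤hi m n = begin
        lo (I m)           ≤⟨ lo-mono (ℕ.≤⇒≤′ (ℕ.m≤m⊔n m n)) ⟩
        lo (I (m ℕ.⊔ n))   ≤⟨ proj₁ (lo<hi (I (m ℕ.⊔ n))) ⟩
        hi (I (m ℕ.⊔ n))   ≤⟨ hi-anti (ℕ.≤⇒≤′ (ℕ.m≤n⊔m m n)) ⟩
        hi (I n)           ∎

      -- Every left end is below every right end, so the supremum of the left ends belongs to all
      -- the intervals, whatever their lengths tend to.
      sup = supremum (λ x → ∃[ n ] x ≈ lo (I n)) (lo I₀ , 0 , refl)
        (hi I₀ , λ (n , x≈) → ≤-trans (≤-reflexive x≈) (lo≤hi n 0))

      sup-∈ : ∀ n → proj₁ sup ∈ I n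
      sup-∈ n = proj₁ (proj₂ sup) (n , refl) ,
        proj₂ (proj₂ sup) (λ (m , x≈) → ≤-trans (≤-reflexive x≈) (lo≤hi m n))

    uncovered : ∃[ x ] (x ∈ I₀ × ∀ n → ¬ x ≈ z n)
    uncovered = proj₁ sup , sup-∈ 0 , λ n → proj₂ (proj₂ (proj₂ (avoid (z n) (I n)))) (sup-∈ (suc n))

-- Least elements and record minima of a sequence.

module LeastElement (em : ExcludedMiddle 0ℓ) (P : ℕ → Set) where

  private
    search : ∀ n → ∃ (IsMinimum ℕ._≤_ P) ⊎ (∀ {k} → k ℕ.< n → ¬ P k)
    search zero = inj₂ λ ()
    search (suc n) with search n | em {P n}
    ... | inj₁ min  | _      = inj₁ min
    ... | inj₂ none | yes pn = inj₁ (n , pn , λ pk → ℕ.≮⇒≥ λ k<n → none k<n pk)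
    ... | inj₂ none | no ¬pn = inj₂ λ k<1+n pk →
      [ (λ k<n → none k<n pk) , (λ { ≡.refl → ¬pn pk }) ]′ (ℕ.m<1+n⇒m<n∨m≡n k<1+n)

  least : ∃ P → ∃ (IsMinimum ℕ._≤_ P)
  least (n , pn) = [ id , (λ none → contradiction pn (none ℕ.≤-refl)) ]′ (search (suc n))

module RecordMinima (em : ExcludedMiddle 0ℓ) (ℝ : CompleteOrderedField)
  (D : ℕ → CompleteOrderedField.Carrier ℝ) where
  open CompleteOrderedField ℝ using (_≤_; ≤-trans; ≤-reflexive; reflexive)
  open Order ℝ

  -- Totality turns the negation into D k < D q, and when `Improves` fails, `em` recovers
  -- `D q ≤ D k` by double negation.
  Improves : ℕ → ℕ → Set
  Improves q k = 1 ℕ.≤ k × ¬ D q ≤ D k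

  module _ (improvable : ∀ {q} → 1 ℕ.≤ q → ∃ (Improves q)) where
    private
      next : ∀ q → 1 ℕ.≤ q → ∃ (IsMinimum ℕ._≤_ (Improves q))
      next q 1≤q = LeastElement.least em (Improves q) (improvable 1≤q)

    denominator : ℕ → ∃[ q ] 1 ℕ.≤ q
    denominator zero    = 1 , ℕ.≤-refl
    denominator (suc n) =
      let q , (1≤q , _) , _ = next (proj₁ (denominator n)) (proj₂ (denominator n)) in q , 1≤q

    q : ℕ → ℕ
    q n = proj₁ (denominator n)

    1≤q : ∀ n → 1 ℕ.≤ q n
    1≤q n = proj₂ (denominator n)

    q-minimal : ∀ n → IsMinimum ℕ._≤_ (Improves (q n)) (q (suc n))
    q-minimal n = proj₂ (next (q n) (1≤q n))

    q-unimproved : ∀ n k → 1 ℕ.≤ k → k ℕ.< q (suc n) → D (q n) ≤ D k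
    q-unimproved n k 1≤k k<q = decidable-stable em
      λ D≰D → ℕ.<⇒≱ k<q (proj₂ (q-minimal n) (1≤k , D≰D))

    -- Below `q (suc n)` nothing improves on `q n`, and `q (suc n)` itself does. Taking `k` to be 1
    -- later bounds all records by `D 1`.
    q-best : ∀ n k → 1 ℕ.≤ k → k ℕ.≤ q n → D (q n) ≤ D k
    q-best zero    k 1≤k k≤1 = ≤-reflexive (reflexive (≡.cong D (ℕ.≤-antisym 1≤k k≤1)))
    q-best (suc n) k 1≤k k≤q =
      [ (λ k<q → ≤-trans (≰⇒≥ (proj₂ (proj₁ (q-minimal n)))) (q-unimproved n k 1≤k k<q))
      , (λ k≡q → ≤-reflexive (reflexive (≡.cong D (≡.sym k≡q))))
      ]′ (ℕ.m≤n⇒m<n∨m≡n k≤q)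

    q-increasing : ∀ n → q n ℕ.< q (suc n)
    q-increasing n = ℕ.≰⇒> λ q′≤q →
      proj₂ (proj₁ (q-minimal n)) (q-best n (q (suc n)) (1≤q (suc n)) q′≤q)

    n<q : ∀ n → n ℕ.< q n
    n<q zero    = ℕ.≤-refl
    n<q (suc n) = ℕ.<-≤-trans (ℕ.s≤s (n<q n)) (q-increasing n)

-- Dirichlet's theorem for multiples of an irrational number.

module Approximation (em : ExcludedMiddle 0ℓ) (ℝ : CompleteOrderedField)
  {α : CompleteOrderedField.Carrier ℝ}
  (0≤α : CompleteOrderedField._≤_ ℝ (CompleteOrderedField.0# ℝ) α)
  (irrational : ¬ CompleteOrderedField.IsRational ℝ α) where
  open CompleteOrderedField ℝ hiding (zero)
  open IntegerEmbedding ℝ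
  open SquareRoot ℝ using (0≤fromℕ)
  open Order ℝ
  open Archimedean em ℝ

  0≤kα : ∀ k → 0# ≤ fromℕ k * α
  0≤kα k = *-nonNegative (0≤fromℕ k) 0≤α

  abstract
    nearest-multiple : ∀ k → ∃ (IsNearest (fromℕ k * α))
    nearest-multiple k = nearest (0≤kα k)

  near : ℕ → ℤ
  near k = proj₁ (nearest-multiple k)

  D : ℕ → Carrier
  D k = ∣ fromℕ k * α - fromℤ (near k) ∣

  D-least : ∀ k r → D k ≤ ∣ fromℕ k * α - fromℤ r ∣
  D-least k = proj₂ (nearest-multiple k)

  D-positive : ∀ {k} → 1 ℕ.≤ k → 0# < D k
  D-positive {suc k} _ = ≰⇒> λ D≤0 → irrational
    (near (suc k) , k , GroupProperties.x∙y⁻¹≈ε⇒x≈y +-group _ _ (∣x∣≤0⇒x≈0 D≤0))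

  module _ (N : ℕ) where
    private
      M : Carrier
      M = fromℕ (suc N)

      a : ℕ → ℕ
      a i = proj₁ (integerPart (0≤kα i))

      -- The fractional part of iα stretched to [0 , M], so that the bins are unit intervals.
      y : ℕ → Carrier
      y i = M * (fromℕ i * α - fromℕ (a i))

      0≤y : ∀ i → 0# ≤ y i
      0≤y i = *-nonNegative (0≤fromℕ (suc N)) (≤⇒0≤- (proj₁ (proj₂ (integerPart (0≤kα i)))))

      y≤M : ∀ i → y i ≤ M
      y≤M i = ≤-respʳ-≈ (*-identityʳ M) (*-monoˡ-≤ (0≤fromℕ (suc N)) (≤-by
        (solve 3 (λ x a o → (o :+ a) :- x := o :- (x :- a)) refl (fromℕ i * α) (fromℕ (a i)) 1#)
        (proj₂ (proj₂ (integerPart (0≤kα i))))))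

      b : ∀ i → ∃[ m ] (m ℕ.≤ N × fromℕ m ≤ y i × y i ≤ fromℕ (suc m))
      b i = floor N (0≤y i) (y≤M i)

      bin : ℕ → Fin (suc N)
      bin i = Fin.fromℕ< (ℕ.s≤s (proj₁ (proj₂ (b i))))

      y-y≤1 : ∀ i j → proj₁ (b i) ≡ proj₁ (b j) → y j - y i ≤ 1#
      y-y≤1 i j bi≡bj = ≤-by
        (solve 4 (λ yi yj m o → ((o :+ m) :+ yi) :- (yj :+ m) := o :- (yj :- yi)) refl
          (y i) (y j) (fromℕ (proj₁ (b j))) 1#)
        (+-mono-≤ (proj₂ (proj₂ (proj₂ (b j))))
          (≡.subst (λ m → fromℕ m ≤ y i) bi≡bj (proj₁ (proj₂ (proj₂ (b i))))))

      -- Two multiples in one bin have fractional parts within 1/M, so (j - i)α is that close to the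
      -- integer `a j ⊖ a i`.
      collision : ∀ i j → i ℕ.< j → proj₁ (b i) ≡ proj₁ (b j) → M * D (j ℕ.∸ i) ≤ 1#
      collision i j i<j bi≡bj = ≤-trans
        (*-monoˡ-≤ (0≤fromℕ (suc N)) (D-least (j ℕ.∸ i) (a j ⊖ a i)))
        (*-∣-∣-≤ (≤-respˡ-≈ (sym M*t≈) (y-y≤1 i j bi≡bj))
          (≤-respˡ-≈
            (trans (solve 2 (λ u v → u :- v := :- (v :- u)) refl (y i) (y j)) (-‿cong (sym M*t≈)))
            (y-y≤1 j i (≡.sym bi≡bj))))
        where
        j≈ : fromℕ j ≈ fromℕ (j ℕ.∸ i) + fromℕ i
        j≈ = trans (reflexive (≡.cong fromℕ (≡.sym (ℕ.m∸n+n≡m (ℕ.<⇒≤ i<j))))) (fromℕ-+ (j ℕ.∸ i) i)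

        M*t≈ : M * (fromℕ (j ℕ.∸ i) * α - fromℤ (a j ⊖ a i)) ≈ y j - y i
        M*t≈ = trans (*-congˡ (+-congˡ (-‿cong (fromℤ-⊖ (a j) (a i)))))
          (trans
            (solve 6 (λ m k i x aj ai →
                m :* (k :* x :- (aj :- ai)) := m :* ((k :+ i) :* x :- aj) :- m :* (i :* x :- ai))
              refl M (fromℕ (j ℕ.∸ i)) (fromℕ i) α (fromℕ (a j)) (fromℕ (a i)))
            (+-congʳ (*-congˡ (+-congʳ (*-congʳ (sym j≈))))))

    dirichlet : ∃[ k ] (1 ℕ.≤ k × k ℕ.≤ suc N × M * D k ≤ 1#)
    dirichlet =
      -- The N + 2 multiples with indices 0 to N + 1 share N + 1 bins. Including index 0 keeps the
      -- difference of two indices at most N + 1.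
      let i , j , i<j , bin≡ = Fin.pigeonhole (ℕ.n<1+n (suc N)) (λ i → bin (Fin.toℕ i))
      in Fin.toℕ j ℕ.∸ Fin.toℕ i , ℕ.m<n⇒0<n∸m i<j ,
         ℕ.≤-trans (ℕ.m∸n≤m (Fin.toℕ j) (Fin.toℕ i)) (Fin.toℕ≤pred[n] j) ,
         collision (Fin.toℕ i) (Fin.toℕ j) i<j (Fin.fromℕ<-injective _ _ _ _ bin≡)

  -- With N at least 1/ε, Dirichlet gives D k ≤ 1/(N + 1), and the extra 1 in the denominator makes
  -- this strictly less than ε.
  small : ∀ {ε} → 0# < ε → ∃[ k ] (1 ℕ.≤ k × ¬ ε ≤ D k)
  small {ε} 0<ε =
    let N , w≤N = archimedean (proj₁ (reciprocal 0<ε))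
        k , 1≤k , _ , MD≤1 = dirichlet N
    in k , 1≤k , λ ε≤D → <⇒≱ 0<ε (+-cancelʳ-≤ (begin
      ε + 1#                          ≈⟨ +-congˡ (proj₂ (proj₂ (reciprocal 0<ε))) ⟨
      ε + ε * proj₁ (reciprocal 0<ε)  ≤⟨ +-mono-≤ ≤-refl (*-monoˡ-≤ (proj₁ 0<ε) w≤N) ⟩
      ε + ε * fromℕ N                 ≈⟨ +-congʳ (*-identityʳ ε) ⟨
      ε * 1# + ε * fromℕ N            ≈⟨ distribˡ ε 1# (fromℕ N) ⟨
      ε * fromℕ (suc N)               ≤⟨ *-monoʳ-≤ (0≤fromℕ (suc N)) ε≤D ⟩
      D k * fromℕ (suc N)             ≈⟨ *-comm _ _ ⟩
      fromℕ (suc N) * D k             ≤⟨ MD≤1 ⟩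
      1#                              ≈⟨ +-identityˡ 1# ⟨
      0# + 1#                         ∎))

  abstract
    improvable : ∀ {q} → 1 ℕ.≤ q → ∃[ k ] (1 ℕ.≤ k × ¬ D q ≤ D k)
    improvable 1≤q = small (D-positive 1≤q)

  -- Dirichlet with n - 1 bins finds a multiple k < n, whence (n - 1)d ≤ 1. The factor 2 comes from
  -- n ≤ 2(n - 1), which is where n > 1 is used.
  n*d≤2 : ∀ {n d} → 1 ℕ.< n → 0# ≤ d → (∀ k → 1 ℕ.≤ k → k ℕ.< n → d ≤ D k) →
          fromℕ n * d ≤ 1# + 1#
  n*d≤2 {suc (suc N)} {d} (ℕ.s≤s (ℕ.s≤s _)) 0≤d d≤D = begin
    (1# + M) * d     ≈⟨ distribʳ d 1# M ⟩
    1# * d + M * d   ≤⟨ +-mono-≤ (*-monoʳ-≤ 0≤d 1≤M) ≤-refl ⟩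
    M * d + M * d    ≤⟨ +-mono-≤ Md≤1 Md≤1 ⟩
    1# + 1#          ∎
    where
    M : Carrier
    M = fromℕ (suc N)

    1≤M : 1# ≤ M
    1≤M = ≤-respˡ-≈ fromℕ-1 (fromℕ-mono 1 (suc N) (ℕ.s≤s ℕ.z≤n))

    Md≤1 : M * d ≤ 1#
    Md≤1 = let k , 1≤k , k≤1+N , MDk≤1 = dirichlet N in
      ≤-trans (*-monoˡ-≤ (0≤fromℕ (suc N)) (d≤D k 1≤k (ℕ.s≤s k≤1+N))) MDk≤1

-- Bounds on square roots.

module SquareRootBounds (em : ExcludedMiddle 0ℓ) (ℝ : CompleteOrderedField) where
  open CompleteOrderedField ℝ hiding (zero)
  open IntegerEmbedding ℝ
  open SquareRoot ℝ
  open Order ℝ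
  open Archimedean em ℝ

  √-isSupremum : ∀ x (0≤x : 0# ≤ x) → IsSupremum _≤_ (λ y → y * y ≤ x) (√ x 0≤x)
  √-isSupremum x 0≤x = proj₂ (supremum (λ y → y * y ≤ x) _ _)

  √-nonNegative : ∀ {x} (0≤x : 0# ≤ x) → 0# ≤ √ x 0≤x
  √-nonNegative {x} 0≤x = proj₁ (√-isSupremum x 0≤x) (≤-respˡ-≈ (sym (zeroˡ 0#)) 0≤x)

  -- If y² ≤ x ≤ s² and y > s ≥ 0, then y² ≤ s² ≤ ys, and cancelling y gives y ≤ s.
  √-least : ∀ {x s} (0≤x : 0# ≤ x) → 0# ≤ s → x ≤ s * s → √ x 0≤x ≤ s
  √-least {x} {s} 0≤x 0≤s x≤s² = proj₂ (√-isSupremum x 0≤x) y≤s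
    where
    y≤s : IsUpperBound _≤_ (λ y → y * y ≤ x) s
    y≤s {y} y²≤x = decidable-stable em λ y≰s →
      let s<y = ≰⇒> y≰s
          0<y = ≰⇒> λ y≤0 → y≰s (≤-trans y≤0 0≤s)
      in y≰s (*-cancelˡ-≤ 0<y (≤-trans y²≤x (≤-trans x≤s² (*-monoʳ-≤ 0≤s (proj₁ s<y)))))

  -- Once n ≥ 1/η², the root of n is at most ηn, which trades the root for the product nd that is
  -- bounded by 2.
  √[n]d-vanishes : ∀ {L ε} → 0# < L → 0# < ε → ∃[ N ] ∀ n (0≤n : 0# ≤ fromℕ n) d → N ℕ.≤ n →
    0# ≤ d → fromℕ n * d ≤ 1# + 1# → √ (fromℕ n) 0≤n * (d * L) < ε
  √[n]d-vanishes {L} {ε} 0<L 0<ε = N , vanishes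
    where
    -- The estimates below are weak. Aiming at ε′ < ε makes the final one strict.
    ε′ = proj₁ (between 0<ε)
    0<ε′ = proj₁ (proj₂ (between 0<ε))
    ε′<ε = proj₂ (proj₂ (between 0<ε))

    K = proj₁ (reciprocal (*-positive 0<2 0<L))
    0<K = proj₁ (proj₂ (reciprocal (*-positive 0<2 0<L)))
    2LK≈1 = proj₂ (proj₂ (reciprocal (*-positive 0<2 0<L)))

    -- Here K = 1/(2L), so that 2ηL = ε′.
    η = ε′ * K

    0<η : 0# < η
    0<η = *-positive 0<ε′ 0<K

    w = proj₁ (reciprocal (*-positive 0<η 0<η))
    η²w≈1 = proj₂ (proj₂ (reciprocal (*-positive 0<η 0<η)))

    N : ℕ
    N = proj₁ (archimedean w)

    module _ (n : ℕ) (0≤n : 0# ≤ fromℕ n) (N≤n : N ℕ.≤ n) where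
      √n≤ηn : √ (fromℕ n) 0≤n ≤ η * fromℕ n
      √n≤ηn = √-least 0≤n (*-nonNegative (proj₁ 0<η) 0≤n) (begin
        fromℕ n                       ≈⟨ *-identityˡ _ ⟨
        1# * fromℕ n                  ≈⟨ *-congʳ η²w≈1 ⟨
        η * η * w * fromℕ n           ≤⟨ *-monoʳ-≤ 0≤n (*-monoˡ-≤ (proj₁ (*-positive 0<η 0<η))
          (≤-trans (proj₂ (archimedean w)) (fromℕ-mono N n N≤n))) ⟩
        η * η * fromℕ n * fromℕ n     ≈⟨
          solve 2 (λ e n → e :* e :* n :* n := e :* n :* (e :* n)) refl η (fromℕ n) ⟩
        η * fromℕ n * (η * fromℕ n)   ∎)

    vanishes : ∀ n (0≤n : 0# ≤ fromℕ n) d → N ℕ.≤ n → 0# ≤ d → fromℕ n * d ≤ 1# + 1# →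
               √ (fromℕ n) 0≤n * (d * L) < ε
    vanishes n 0≤n d N≤n 0≤d nd≤2 = begin-strict
      √ (fromℕ n) 0≤n * (d * L)  ≤⟨ *-monoʳ-≤ (*-nonNegative 0≤d (proj₁ 0<L)) (√n≤ηn n 0≤n N≤n) ⟩
      η * fromℕ n * (d * L)      ≈⟨
        solve 4 (λ e n d l → e :* n :* (d :* l) := e :* l :* (n :* d)) refl η (fromℕ n) d L ⟩
      η * L * (fromℕ n * d)      ≤⟨ *-monoˡ-≤ (*-nonNegative (proj₁ 0<η) (proj₁ 0<L)) nd≤2 ⟩
      η * L * (1# + 1#)          ≈⟨
        solve 4 (λ e k l t → e :* k :* l :* t := t :* l :* k :* e) refl ε′ K L (1# + 1#) ⟩
      (1# + 1#) * L * K * ε′     ≈⟨ *-congʳ 2LK≈1 ⟩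
      1# * ε′                    ≈⟨ *-identityˡ ε′ ⟩
      ε′                         <⟨ ε′<ε ⟩
      ε                          ∎

-- A lower bound for the norm away from the axis.

module AxisNorm (ℝ : CompleteOrderedField) (norm : Plane.Norm ℝ) where
  open CompleteOrderedField ℝ hiding (zero)
  open IntegerEmbedding ℝ
  open Order ℝ
  open Plane ℝ
  open Norm norm renaming (cong to ‖‖-cong)

  L : Carrier
  L = ‖ 1# , 0# ‖

  0<L : 0# < L
  0<L = ≤∧≉⇒< (nonNegative _) λ 0≈L → 0≉1 (sym (proj₁ (definite (sym 0≈L))))

  ‖x,0‖≈∣x∣L : ∀ x → ‖ x , 0# ‖ ≈ ∣ x ∣ * L
  ‖x,0‖≈∣x∣L x = trans (‖‖-cong (sym (*-identityʳ x) , sym (zeroʳ x))) (homogeneous x (1# , 0#))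

  ‖-v‖≈‖v‖ : ∀ v → ‖ - 1# *ₗ v ‖ ≈ ‖ v ‖
  ‖-v‖≈‖v‖ v = trans (homogeneous (- 1#) v) (trans (*-congʳ ∣-1∣≈1) (*-identityˡ _))
    where
    ∣-1∣≈1 : ∣ - 1# ∣ ≈ 1#
    ∣-1∣≈1 = trans (∣-∣-cong (sym (+-identityˡ (- 1#))))
      (trans (∣x-y∣≈y-x 0≤1) (solve 1 (λ o → o :- con (+ 0) := o) refl 1#))

  private
    g : Carrier → Carrier
    g t = ‖ t , 1# ‖

    g-lipschitz : ∀ s t → g s ≤ ∣ s - t ∣ * L + g t
    g-lipschitz s t = begin
      ‖ s , 1# ‖                          ≈⟨ ‖‖-cong
        (solve 2 (λ s t → s := (s :- t) :+ t) refl s t , sym (+-identityˡ 1#)) ⟩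
      ‖ (s - t , 0#) +ᴹ (t , 1#) ‖        ≤⟨ triangle _ _ ⟩
      ‖ s - t , 0# ‖ + g t                ≈⟨ +-congʳ (‖x,0‖≈∣x∣L (s - t)) ⟩
      ∣ s - t ∣ * L + g t                 ∎

    -- The difference of two points at height 1 lies on the axis, where the norm is a multiple of
    -- the absolute value.
    g-separated : ∀ s t → ∣ s - t ∣ * L ≤ g s + g t
    g-separated s t = begin
      ∣ s - t ∣ * L                       ≈⟨ ‖x,0‖≈∣x∣L (s - t) ⟨
      ‖ s - t , 0# ‖                      ≈⟨ ‖‖-cong
        ( trans (solve 2 (λ s t → s :- t := s :+ :- (t)) refl s t) (+-congˡ (-t≈ t))
        , trans (sym (-‿inverseʳ 1#)) (+-congˡ (-t≈ 1#))) ⟩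
      ‖ (s , 1#) +ᴹ (- 1# *ₗ (t , 1#)) ‖  ≤⟨ triangle _ _ ⟩
      g s + ‖ - 1# *ₗ (t , 1#) ‖          ≈⟨ +-congˡ (‖-v‖≈‖v‖ (t , 1#)) ⟩
      g s + g t                           ∎
      where
      -t≈ : ∀ t → - t ≈ - 1# * t
      -t≈ t = trans (-‿cong (sym (*-identityˡ t)))
        (solve 2 (λ o t → :- (o :* t) := :- o :* t) refl 1# t)

    K : Carrier
    K = proj₁ (reciprocal 0<L)

    0≤K : 0# ≤ K
    0≤K = proj₁ (proj₁ (proj₂ (reciprocal 0<L)))

    LK≈1 : L * K ≈ 1#
    LK≈1 = proj₂ (proj₂ (reciprocal 0<L))

    f : Carrier → Carrier
    f t = K * g t

    f-separated : ∀ s t → s - t ≤ f s + f t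
    f-separated s t = begin
      s - t                     ≤⟨ x≤∣x∣ _ ⟩
      ∣ s - t ∣                 ≈⟨ *-identityˡ _ ⟨
      1# * ∣ s - t ∣            ≈⟨ *-congʳ LK≈1 ⟨
      L * K * ∣ s - t ∣         ≈⟨ solve 3 (λ l k d → l :* k :* d := k :* (d :* l)) refl L K ∣ s - t ∣ ⟩
      K * (∣ s - t ∣ * L)       ≤⟨ *-monoˡ-≤ 0≤K (g-separated s t) ⟩
      K * (g s + g t)           ≈⟨ distribˡ K (g s) (g t) ⟩
      f s + f t                 ∎

    -- Helly's theorem on the line: intervals that meet pairwise have every left end below every
    -- right end, so the supremum of the left ends is a common point.
    below : ∀ s t → s - f s ≤ t + f t
    below s t = ≤-by
      (solve 4 (λ s t fs ft → (fs :+ ft) :- (s :- t) := (t :+ ft) :- (s :- fs)) refl s t (f s) (f t))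
      (f-separated s t)

    sup = supremum (λ x → ∃[ t ] x ≈ t - f t) (0# - f 0# , 0# , refl)
      (0# + f 0# , λ (t , x≈) → ≤-trans (≤-reflexive x≈) (below t 0#))

    -- g is minimal up to a factor of 2 at t₀, which replaces a compactness argument:
    -- the intervals [t - f t , t + f t] meet pairwise, and t₀ lies in all of them.
    t₀ : Carrier
    t₀ = proj₁ sup

    ∣t₀-t∣≤f : ∀ t → ∣ t₀ - t ∣ ≤ f t
    ∣t₀-t∣≤f t = ∣x∣≤
      (≤-by (solve 3 (λ s t ft → (t :+ ft) :- s := ft :- (s :- t)) refl t₀ t (f t))
        (proj₂ (proj₂ sup) λ (s , x≈) → ≤-trans (≤-reflexive x≈) (below s t)))
      (≤-by (solve 3 (λ s t ft → s :- (t :- ft) := ft :- :- (s :- t)) refl t₀ t (f t))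
        (proj₁ (proj₂ sup) (t , refl)))

    -- Moving from `t` to `t₀` raises `g` by at most L times their distance, which is at most L
    -- times `f t`, that is, `g t`.
    g[t₀]≤2g : ∀ t → g t₀ ≤ g t + g t
    g[t₀]≤2g t = begin
      g t₀                     ≤⟨ g-lipschitz t₀ t ⟩
      ∣ t₀ - t ∣ * L + g t     ≤⟨ +-mono-≤ (*-monoʳ-≤ (proj₁ 0<L) (∣t₀-t∣≤f t)) ≤-refl ⟩
      K * g t * L + g t        ≈⟨ +-congʳ (solve 3 (λ k g l → k :* g :* l := l :* k :* g) refl K (g t) L) ⟩
      L * K * g t + g t        ≈⟨ +-congʳ (*-congʳ LK≈1) ⟩
      1# * g t + g t           ≈⟨ +-congʳ (*-identityˡ _) ⟩
      g t + g t                ∎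

    0<g : ∀ t → 0# < g t
    0<g t = ≤∧≉⇒< (nonNegative _) λ 0≈g → 0≉1 (sym (proj₂ (definite (sym 0≈g))))

    c : Carrier
    c = proj₁ (half (g t₀))

    c+c≈g : c + c ≈ g t₀
    c+c≈g = proj₂ (half (g t₀))

    c≤g : ∀ t → c ≤ g t
    c≤g t = x+x≤y+y⇒x≤y (≤-trans (≤-reflexive c+c≈g) (g[t₀]≤2g t))

    c≤‖‖ : ∀ x y → 1# ≤ ∣ y ∣ → c ≤ ‖ x , y ‖
    c≤‖‖ x y 1≤∣y∣ = begin
      -- Division by y brings the point to height 1, and scaling back by y cannot shrink the norm
      -- since 1 ≤ |y|.
      c                               ≤⟨ c≤g (z * x) ⟩
      g (z * x)                       ≈⟨ *-identityˡ _ ⟨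
      1# * g (z * x)                  ≤⟨ *-monoʳ-≤ (nonNegative _) 1≤∣y∣ ⟩
      ∣ y ∣ * g (z * x)               ≈⟨ homogeneous y (z * x , 1#) ⟨
      ‖ y * (z * x) , y * 1# ‖        ≈⟨ ‖‖-cong
        (trans (sym (*-assoc y z x)) (trans (*-congʳ yz≈1) (*-identityˡ x)) , *-identityʳ y) ⟩
      ‖ x , y ‖                       ∎
      where
      y≉0 : ¬ y ≈ 0#
      y≉0 y≈0 = 1≰0 (≤-trans 1≤∣y∣ (≤-reflexive (trans (∣-∣-cong y≈0) (0≤x⇒∣x∣≈x ≤-refl))))

      z : Carrier
      z = proj₁ (inverse y y≉0)

      yz≈1 : y * z ≈ 1#
      yz≈1 = proj₂ (inverse y y≉0)

  abstract
    off-axis : ∃[ c ] (0# < c × ∀ x y → 1# ≤ ∣ y ∣ → c ≤ ‖ x , y ‖)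
    off-axis = c , half-positive c+c≈g (0<g t₀) , c≤‖‖

-- Best approximations of a vector on the axis.

module AxisVector (em : ExcludedMiddle 0ℓ) (ℝ : CompleteOrderedField) (norm : Plane.Norm ℝ)
  {α : CompleteOrderedField.Carrier ℝ}
  (0≤α : CompleteOrderedField._≤_ ℝ (CompleteOrderedField.0# ℝ) α)
  (irrational : ¬ CompleteOrderedField.IsRational ℝ α) where
  open CompleteOrderedField ℝ hiding (zero)
  open IntegerEmbedding ℝ
  open SquareRoot ℝ using (√; 0≤fromℕ)
  open Order ℝ
  open Plane ℝ
  open Norm norm renaming (cong to ‖‖-cong)
  open AxisNorm ℝ norm
  open BestApproximations ℝ norm
  open Approximation em ℝ 0≤α irrational
  open RecordMinima em ℝ D
  open SquareRootBounds em ℝ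

  v : Vector
  v = α , 0#

  k0-0≈0 : ∀ k → fromℕ k * 0# - 0# ≈ 0#
  k0-0≈0 k = solve 1 (λ k → k :* con (+ 0) :- con (+ 0) := con (+ 0)) refl (fromℕ k)

  ‖kv-r‖ : ∀ k r → ‖ fromℕ k *ₗ v -ᴹ fromℤ² (r , + 0) ‖ ≈ ∣ fromℕ k * α - fromℤ r ∣ * L
  ‖kv-r‖ k r = trans (‖‖-cong (refl , k0-0≈0 k)) (‖x,0‖≈∣x∣L _)

  1≤∣k0-s∣ : ∀ k s → ¬ s ≡ + 0 → 1# ≤ ∣ fromℕ k * 0# - fromℤ s ∣
  1≤∣k0-s∣ k (+ zero)  s≢0 = contradiction ≡.refl s≢0
  1≤∣k0-s∣ k (+ suc n) _   = begin
    1#                                  ≈⟨ fromℕ-1 ⟨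
    fromℕ 1                             ≤⟨ fromℕ-mono 1 (suc n) (ℕ.s≤s ℕ.z≤n) ⟩
    fromℕ (suc n)                       ≈⟨
      solve 2 (λ k s → s := :- (k :* con (+ 0) :- s)) refl (fromℕ k) (fromℕ (suc n)) ⟩
    - (fromℕ k * 0# - fromℕ (suc n))    ≤⟨ -x≤∣x∣ _ ⟩
    ∣ fromℕ k * 0# - fromℕ (suc n) ∣    ∎
  1≤∣k0-s∣ k -[1+ n ]  _   = begin
    1#                                  ≈⟨ fromℕ-1 ⟨
    fromℕ 1                             ≤⟨ fromℕ-mono 1 (suc n) (ℕ.s≤s ℕ.z≤n) ⟩
    fromℕ (suc n)                       ≈⟨
      solve 2 (λ k s → s := k :* con (+ 0) :- :- s) refl (fromℕ k) (fromℕ (suc n)) ⟩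
    fromℕ k * 0# - - fromℕ (suc n)      ≤⟨ x≤∣x∣ _ ⟩
    ∣ fromℕ k * 0# - - fromℕ (suc n) ∣  ∎

  module _ {c : Carrier} (off-axis : ∀ x y → 1# ≤ ∣ y ∣ → c ≤ ‖ x , y ‖) (αL≤c : α * L ≤ c) where

    private
      p : ℕ → ℤ × ℤ
      p k = near k , + 0

      dist : ℕ → Carrier
      dist k = ‖ fromℕ k *ₗ v -ᴹ fromℤ² (p k) ‖

    -- Lattice points on the axis are handled by `D`, the others by `c`. Equal indices yield the
    -- minimum at `j`; different ones compare `j` with all lattice distances of `k`.
    dist-≤ : ∀ j k → D j * L ≤ c → D j ≤ D k → ∀ rs → dist j ≤ ‖ fromℕ k *ₗ v -ᴹ fromℤ² rs ‖
    dist-≤ j k DjL≤c Dj≤Dk (r , s) = cases s em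
      where
      cases : ∀ s → Dec (s ≡ + 0) → dist j ≤ ‖ fromℕ k *ₗ v -ᴹ fromℤ² (r , s) ‖
      cases _ (yes ≡.refl) = begin
        dist j                                 ≈⟨ ‖kv-r‖ j (near j) ⟩
        D j * L                                ≤⟨ *-monoʳ-≤ (proj₁ 0<L) (≤-trans Dj≤Dk (D-least k r)) ⟩
        ∣ fromℕ k * α - fromℤ r ∣ * L          ≈⟨ ‖kv-r‖ k r ⟨
        ‖ fromℕ k *ₗ v -ᴹ fromℤ² (r , + 0) ‖   ∎
      cases s (no s≢0) = begin
        dist j                                 ≈⟨ ‖kv-r‖ j (near j) ⟩
        D j * L                                ≤⟨ DjL≤c ⟩
        c                                      ≤⟨ off-axis _ _ (1≤∣k0-s∣ k s s≢0) ⟩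
        ‖ fromℕ k *ₗ v -ᴹ fromℤ² (r , s) ‖     ∎

    dist-attained : ∀ k → D k * L ≤ c → ⟨ fromℕ k *ₗ v ⟩≐ dist k
    dist-attained k DL≤c = (p k , refl) ,
      λ (rs , eq) → ≤-respʳ-≈ eq (dist-≤ k k DL≤c ≤-refl rs)

    improvement⇒< : ∀ j k → D j * L ≤ c → ¬ D j ≤ D k → v ⟨ k ⟩<⟨ j ⟩
    improvement⇒< j k DjL≤c Dj≰Dk =
      dist k , dist j , dist-attained k DkL≤c , dist-attained j DjL≤c , ≰⇒> λ dj≤dk →
        Dj≰Dk (*-cancelˡ-≤ 0<L (begin
          L * D j   ≈⟨ *-comm L (D j) ⟩
          D j * L   ≈⟨ ‖kv-r‖ j (near j) ⟨
          dist j    ≤⟨ dj≤dk ⟩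
          dist k    ≈⟨ ‖kv-r‖ k (near k) ⟩
          D k * L   ≈⟨ *-comm (D k) L ⟩
          L * D k   ∎))
      where
      DkL≤c : D k * L ≤ c
      DkL≤c = ≤-trans (*-monoʳ-≤ (proj₁ 0<L) (≰⇒≥ Dj≰Dk)) DjL≤c

    -- The minimum at `k` may be attained off the axis. This is covered because `dist-≤` bounds only
    -- `D j` and allows any lattice point for `k`.
    <⇒improvement : ∀ j k → D j * L ≤ c → v ⟨ k ⟩<⟨ j ⟩ → ¬ D j ≤ D k
    <⇒improvement j k DjL≤c (d , e , ((rs , d≈) , _) , (_ , e≤) , d<e) Dj≤Dk =
      <⇒≱ d<e (≤-trans (e≤ (p j , refl)) (≤-respʳ-≈ d≈ (dist-≤ j k DjL≤c Dj≤Dk rs)))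

    -- The integer 0 competes for the nearest integer to α, so D(1) ≤ α. Here the smallness of α
    -- enters.
    D[1]L≤c : D 1 * L ≤ c
    D[1]L≤c = begin
      D 1 * L                            ≤⟨ *-monoʳ-≤ (proj₁ 0<L) (D-least 1 (+ 0)) ⟩
      ∣ fromℕ 1 * α - 0# ∣ * L           ≈⟨ *-congʳ (∣-∣-cong (trans
        (solve 2 (λ o α → o :* α :- con (+ 0) := o :* α) refl (fromℕ 1) α)
        (trans (*-congʳ fromℕ-1) (*-identityˡ α)))) ⟩
      ∣ α ∣ * L                          ≈⟨ *-congʳ (0≤x⇒∣x∣≈x 0≤α) ⟩
      α * L                              ≤⟨ αL≤c ⟩
      c                                  ∎

    private
      Q : ℕ → ℕ
      Q = q improvable

    D[Q]L≤c : ∀ n → D (Q n) * L ≤ c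
    D[Q]L≤c n = ≤-trans
      (*-monoʳ-≤ (proj₁ 0<L) (q-best improvable n 1 ℕ.≤-refl (1≤q improvable n))) D[1]L≤c

    isBestApproximationsSequence : IsBestApproximationsSequence v Q (λ n → p (Q n))
    isBestApproximationsSequence = record
      { initial    = ≡.refl
      ; increasing = q-increasing improvable
      ; minimal    = λ n →
          let (1≤q′ , improves) , q′≤ = q-minimal improvable n in
          (1≤q′ , improvement⇒< (Q n) (Q (suc n)) (D[Q]L≤c n) improves) ,
          λ (1≤k , k<Q) → q′≤ (1≤k , <⇒improvement (Q n) _ (D[Q]L≤c n) k<Q)
      ; nearest    = λ n → dist-attained (Q n) (D[Q]L≤c n)
      }

    private
      r : ℕ → Carrier
      r n = √ (fromℕ (Q (suc n))) (0≤fromℕ (Q (suc n)))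

    ‖β‖≈ : ∀ n → ‖ β v Q (λ n → p (Q n)) n ‖ ≈ r n * (D (Q n) * L)
    ‖β‖≈ n = trans (homogeneous (r n) _)
      (*-cong (0≤x⇒∣x∣≈x (√-nonNegative (0≤fromℕ (Q (suc n))))) (‖kv-r‖ (Q n) (near (Q n))))

    ‖β‖-vanishes : ∀ {ε} → 0# < ε →
      ∃[ N ] ∀ n → N ℕ.≤ n → ∣ ‖ β v Q (λ n → p (Q n)) n ‖ - 0# ∣ < ε
    ‖β‖-vanishes {ε} 0<ε = N , λ n N≤n → begin-strict
      ∣ ‖ β v Q (λ n → p (Q n)) n ‖ - 0# ∣   ≈⟨ ∣y-x∣≈y-x (nonNegative _) ⟩
      ‖ β v Q (λ n → p (Q n)) n ‖ - 0#       ≈⟨ solve 1 (λ x → x :- con (+ 0) := x) refl _ ⟩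
      ‖ β v Q (λ n → p (Q n)) n ‖            ≈⟨ ‖β‖≈ n ⟩
      r n * (D (Q n) * L)                    <⟨ proj₂ (√[n]d-vanishes 0<L 0<ε)
        (Q (suc n)) (0≤fromℕ (Q (suc n))) (D (Q n))
        -- Denominators grow at least as fast as their indices, so a threshold for q_{n+1} is also
        -- one for n.
        (ℕ.≤-trans N≤n (ℕ.≤-trans (ℕ.n≤1+n n) (ℕ.<⇒≤ (n<q improvable (suc n)))))
        (0≤∣x∣ _)
        (n*d≤2 (ℕ.≤-<-trans (1≤q improvable n) (q-increasing improvable n)) (0≤∣x∣ _)
          (q-unimproved improvable n)) ⟩
      ε                                      ∎
      where
      N : ℕ
      N = proj₁ (√[n]d-vanishes 0<L 0<ε)

    dirichletConverging : DirichletConverging v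
    dirichletConverging = (λ (α∈ℚ , _) → irrational α∈ℚ) , Q , (λ n → p (Q n)) ,
      isBestApproximationsSequence , 0# , ‖β‖-vanishes

-- Irrational numbers avoiding a given sequence.

module Cantor (ℝ : CompleteOrderedField) where
  open CompleteOrderedField ℝ hiding (zero)
  open SquareRoot ℝ using (0≤fromℕ)
  open Order ℝ
  open Uncountability ℝ hiding (_∈_)

  private
    reciprocal-suc : ∀ n → ∃[ y ] (0# < y × fromℕ (suc n) * y ≈ 1#)
    reciprocal-suc n = reciprocal (0<fromℕ-suc n)

    fraction : ℕ → ℕ → Carrier
    fraction m n = proj₁ (reciprocal-suc n) * fromℕ m

    -- Nonnegativity excludes negative numerators, so pairs of natural numbers enumerate every
    -- rational that can occur.
    rational⇒fraction : ∀ {x} → 0# ≤ x → IsRational x → ∃₂ λ m n → x ≈ fraction m n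
    rational⇒fraction {x} _ (+ m , n , nx≈m) = m , n , (begin-equality
      x                       ≈⟨ *-identityˡ x ⟨
      1# * x                  ≈⟨ *-congʳ (proj₂ (proj₂ (reciprocal-suc n))) ⟨
      fromℕ (suc n) * w * x   ≈⟨ *-congʳ (*-comm _ w) ⟩
      w * fromℕ (suc n) * x   ≈⟨ *-assoc w _ x ⟩
      w * (fromℕ (suc n) * x) ≈⟨ *-congˡ nx≈m ⟩
      w * fromℕ m             ∎)
      where
      w : Carrier
      w = proj₁ (reciprocal-suc n)
    rational⇒fraction {x} 0≤x (-[1+ m ] , n , nx≈-m) = contradiction
      (≤-respʳ-≈ (-‿inverseʳ _) (begin
        fromℕ (suc m)                      ≈⟨ +-identityʳ _ ⟨
        fromℕ (suc m) + 0#                 ≤⟨ +-mono-≤ ≤-refl (*-nonNegative (0≤fromℕ (suc n)) 0≤x) ⟩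
        fromℕ (suc m) + fromℕ (suc n) * x  ≈⟨ +-congˡ nx≈-m ⟩
        fromℕ (suc m) - fromℕ (suc m)      ∎))
      (<⇒≱ (0<fromℕ-suc m))

  irrational-uncovered : ∀ {δ} → 0# < δ → (z : ℕ → Carrier) →
    ∃[ x ] (0# ≤ x × x ≤ δ × ¬ IsRational x × ∀ n → ¬ x ≈ z n)
  irrational-uncovered 0<δ z =
    let x , (0≤x , x≤δ) , x≉ = uncovered (λ k → uncurry table (unpair k)) (interval 0<δ)

        x≉table : ∀ i j → ¬ x ≈ table i j
        x≉table i j x≈ = let k , eq = unpair-surjective i j in
          x≉ k (trans x≈ (reflexive (≡.cong (uncurry table) (≡.sym eq))))

    in x , 0≤x , x≤δ ,
       (λ x∈ℚ → let m , n , x≈ = rational⇒fraction 0≤x x∈ℚ in x≉table m (suc n) x≈) ,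
       λ i → x≉table i 0
    where
    -- Column 0 holds the given sequence and column n + 1 the fractions with denominator n + 1, so
    -- avoiding one table gives both irrationality and novelty.
    table : ℕ → ℕ → Carrier
    table i zero    = z i
    table i (suc n) = fraction i n

-- Uncountability of the Dirichlet converging vectors.

corollary2 : ExcludedMiddle 0ℓ → (ℝ : CompleteOrderedField) (norm : Plane.Norm ℝ) →
    ¬ Countable (Plane.≈ᴹ-setoid ℝ) (BestApproximations.DirichletConverging ℝ norm)
corollary2 em ℝ norm countable = x≉z (to ((x , 0#) , converging)) (x≈decode (decodable _) _ ≡.refl)
  where
  open CompleteOrderedField ℝ hiding (zero)
  open Order ℝ
  open BestApproximations ℝ norm
  open AxisNorm ℝ norm
  open Injection countable using (to; injective)

  c : Carrier
  c = proj₁ off-axis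

  -- This is c/L, so x ≤ δ amounts to the smallness condition xL ≤ c.
  δ : Carrier
  δ = proj₁ (reciprocal 0<L) * c

  0<δ : 0# < δ
  0<δ = *-positive (proj₁ (proj₂ (reciprocal 0<L))) (proj₁ (proj₂ off-axis))

  Code : ℕ → Set
  Code i = ∃[ x ] ∃[ x∈DC ] to ((x , 0#) , x∈DC) ≡ i

  decodable : ∀ i → Dec (Code i)
  decodable i = em

  -- A left inverse of the injection on axis points. Indices without a preimage there get the
  -- default `0#`, one more value for `x` to avoid.
  decode : ∀ {i} → Dec (Code i) → Carrier
  decode (yes (x , _)) = x
  decode (no _)        = 0#

  irrational = Cantor.irrational-uncovered ℝ 0<δ (λ i → decode (decodable i))

  x : Carrier
  x = proj₁ irrational

  x≉z : ∀ i → ¬ x ≈ decode (decodable i)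
  x≉z = proj₂ (proj₂ (proj₂ (proj₂ irrational)))

  xL≤c : x * L ≤ c
  xL≤c = begin
    x * L                              ≤⟨ *-monoʳ-≤ (proj₁ 0<L) (proj₁ (proj₂ (proj₂ irrational))) ⟩
    proj₁ (reciprocal 0<L) * c * L     ≈⟨ *-comm _ L ⟩
    L * (proj₁ (reciprocal 0<L) * c)   ≈⟨ *-assoc L _ c ⟨
    L * proj₁ (reciprocal 0<L) * c     ≈⟨ *-congʳ (proj₂ (proj₂ (reciprocal 0<L))) ⟩
    1# * c                             ≈⟨ *-identityˡ c ⟩
    c                                  ∎

  converging : DirichletConverging (x , 0#)
  converging = AxisVector.dirichletConverging em ℝ norm
    (proj₁ (proj₂ irrational)) (proj₁ (proj₂ (proj₂ (proj₂ irrational))))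
    (proj₂ (proj₂ off-axis)) xL≤c

  -- The decision is a variable here so that it can be split into cases; `decodable` is substituted
  -- for it in the conclusion.
  x≈decode : ∀ {i} (d : Dec (Code i)) (x∈DC : DirichletConverging (x , 0#)) →
             to ((x , 0#) , x∈DC) ≡ i → x ≈ decode d
  x≈decode (yes (y , y∈DC , to≡i)) x∈DC to≡ = proj₁ (injective (≡.trans to≡ (≡.sym to≡i)))
  x≈decode (no ∄) x∈DC to≡ = contradiction (x , x∈DC , to≡) ∄
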